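{- For every $n\in\mathbb{N}$, $P\in\mathbb{N}_0$ and $Q\in\{ -P-1,\dots,0\}$, $$\sum_{d\mid n}\varphi\!\left(\frac nd\right)V_d(P,Q)\equiv0\pmod n.$$ In particular, if $n$ is a prime number, then $$V_n(P,Q)\equiv P\pmod n.$$
   Context: $\mathbb{N}$ denotes the positive integers and $\mathbb{N}_0=\mathbb{N}\cup\{0\}$. $\varphi$ is Euler's totient function, and the sum runs over the positive divisors $d$ of $n$. For integers $P,Q$, the Lucas sequence of the second kind is defined by $V_0(P,Q)=2$, $V_1(P,Q)=P$, and $V_n(P,Q)=P\,V_{n-1}(P,Q)-Q\,V_{n-2}(P,Q)$ for $n>1$. -}

module Defs where

open import Data.Integer.Base using (ℤ; +_; _+_; _-_; _*_; 0ℤ)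
open import Data.Integer.Divisibility.Signed using (_∣_)
open import Data.List.Base using (applyUpTo; filter; foldr; length; map; upTo)
open import Data.Nat.Base as ℕ using (ℕ; zero; suc; NonZero)
open import Data.Nat.Coprimality using (coprime?)
import Data.Nat.Divisibility as ℕ

φ : ℕ → ℕ
φ m = length (filter (λ k → coprime? k m) (applyUpTo suc m))

V : ℤ → ℤ → ℕ → ℤ
V P Q zero          = + 2
V P Q (suc zero)    = P
V P Q (suc (suc n)) = P * V P Q (suc n) - Q * V P Q n

-- ∑_{d ∣ n} f d for n > 0. The list ranges over k = d ∸ 1, so that d = suc k
-- is visibly nonzero and f may divide by it.
divisorSum : (n : ℕ) → ((d : ℕ) → .{{NonZero d}} → ℤ) → ℤ
divisorSum n f =
  foldr _+_ 0ℤ (map (λ k → f (suc k)) (filter (λ k → suc k ℕ.∣? n) (upTo n)))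

infix 4 _≡_[mod_]

_≡_[mod_] : ℤ → ℤ → ℕ → Set
a ≡ b [mod n ] = + n ∣ a - b

-- Since φ(n/d) counts the j ≤ n with gcd(j,n) = d, the sum is G(v) = ∑_{j=1}^n v(gcd(j,n)) at v = V, and
-- n ∣ G(w_d) for w_d(k) = d·[d ∣ k]. Up to sign, the generating function of V without its constant term is the
-- logarithmic derivative x g′/g of g = 1 − Px + Qx². Multiplying g by 1 − xᵈ adds w_d to v, so it does not change
-- G(v) mod n. Doing this g_d mod n times, successively for d = 1, …, n, makes g ≡ 1 modulo n and xⁿ⁺¹; then all
-- v(k) with 1 ≤ k ≤ n, and hence G(v), vanish mod n. For prime n, G(v) = (n − 1) v(1) + v(n).
--
-- A power series is its coefficient function; ⊛ is the Cauchy product and shift d is multiplication by xᵈ.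

module Submission where

open import Defs
open import Data.Integer.Base using (ℤ; +_; -_; _+_; _-_; _*_; _≤_; 0ℤ; 1ℤ)
import Data.Integer.DivMod as ℤ
open import Data.Integer.Divisibility.Signed
  using (_∣_; divides; ∣-refl; ∣m∣n⇒∣m+n; ∣m∣n⇒∣m-n; ∣m+n∣n⇒∣m; ∣m⇒∣m*n; ∣n⇒∣m*n)
import Data.Integer.Properties as ℤ
open import Data.Integer.Tactic.RingSolver using (solve-∀)
open import Data.List.Base using (applyUpTo; filter; foldr; length; map)
open import Data.Nat.Base as ℕ using (ℕ; zero; suc; NonZero; _/_; _<_; s≤s; z≤n)
open import Data.Nat.Coprimality using (Coprime; coprime?; coprime⇒gcd≡1; gcd≡1⇒coprime; prime⇒coprime)
  renaming (sym to coprime-sym)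
open import Data.Nat.Divisibility as ℕ using (_∣?_)
open import Data.Nat.DivMod using (m*n/n≡m)
open import Data.Nat.GCD using (gcd; gcd[m,n]∣m; gcd[m,n]∣n; gcd-greatest; gcd[m,n]≤n; c*gcd[m,n]≡gcd[cm,cn])
open import Data.Nat.Primality using (Prime)
import Data.Nat.Properties as ℕ
open import Data.Product.Base using (_×_; _,_)
open import Function.Base using (_∘_; id)
open import Relation.Binary.PropositionalEquality
  using (_≡_; _≗_; refl; sym; trans; cong; cong₂; subst; module ≡-Reasoning)
open import Relation.Nullary using (Dec; yes; no; ¬_; contradiction)
open import Relation.Unary using (Decidable)
open ≡-Reasoning

-- Finite sums of integers.

∑ : ℕ → (ℕ → ℤ) → ℤ
∑ zero    f = 0ℤ
∑ (suc n) f = f 0 + ∑ n (f ∘ suc)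

∑-cong : ∀ n {f g : ℕ → ℤ} → (∀ k → k < n → f k ≡ g k) → ∑ n f ≡ ∑ n g
∑-cong zero    f≗g = refl
∑-cong (suc n) f≗g = cong₂ _+_ (f≗g 0 (s≤s z≤n)) (∑-cong n (λ k k<n → f≗g (suc k) (s≤s k<n)))

∑-const : ∀ n c → ∑ n (λ _ → c) ≡ + n * c
∑-const zero    c = refl
∑-const (suc n) c = trans (cong (_+_ c) (∑-const n c)) (sym (ℤ.suc-* (+ n) c))

∑-zero : ∀ n → ∑ n (λ _ → 0ℤ) ≡ 0ℤ
∑-zero n = trans (∑-const n 0ℤ) (ℤ.*-zeroʳ (+ n))

∑-distrib-+ : ∀ n (f g : ℕ → ℤ) → ∑ n (λ k → f k + g k) ≡ ∑ n f + ∑ n g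
∑-distrib-+ zero    f g = refl
∑-distrib-+ (suc n) f g =
  trans (cong (_+_ (f 0 + g 0)) (∑-distrib-+ n (f ∘ suc) (g ∘ suc))) (interchange (f 0) (g 0) _ _)
  where
  interchange : ∀ a b c d → (a + b) + (c + d) ≡ (a + c) + (b + d)
  interchange = solve-∀

∑-distribʳ-* : ∀ n (f : ℕ → ℤ) c → ∑ n (λ k → f k * c) ≡ ∑ n f * c
∑-distribʳ-* zero    f c = refl
∑-distribʳ-* (suc n) f c =
  trans (cong (_+_ (f 0 * c)) (∑-distribʳ-* n (f ∘ suc) c)) (sym (ℤ.*-distribʳ-+ c (f 0) _))

∑-swap : ∀ m n (f : ℕ → ℕ → ℤ) → ∑ m (λ i → ∑ n (f i)) ≡ ∑ n (λ j → ∑ m (λ i → f i j))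
∑-swap zero    n f = sym (∑-zero n)
∑-swap (suc m) n f = trans (cong (_+_ (∑ n (f 0))) (∑-swap m n (f ∘ suc))) (sym (∑-distrib-+ n _ _))

∑-split : ∀ m n (f : ℕ → ℤ) → ∑ (m ℕ.+ n) f ≡ ∑ m f + ∑ n (λ i → f (m ℕ.+ i))
∑-split zero    n f = sym (ℤ.+-identityˡ _)
∑-split (suc m) n f = trans (cong (_+_ (f 0)) (∑-split m n (f ∘ suc))) (sym (ℤ.+-assoc (f 0) _ _))

∑-∣ : ∀ n {d} {f : ℕ → ℤ} → (∀ k → k < n → d ∣ f k) → d ∣ ∑ n f
∑-∣ zero    d∣f = divides 0ℤ refl
∑-∣ (suc n) d∣f = ∣m∣n⇒∣m+n (d∣f 0 (s≤s z≤n)) (∑-∣ n (λ k k<n → d∣f (suc k) (s≤s k<n)))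

-- Iverson brackets and the sums they select.

⟦_⟧ : ∀ {a} {A : Set a} → Dec A → ℤ
⟦ yes _ ⟧ = 1ℤ
⟦ no  _ ⟧ = 0ℤ

module _ {a} {A : Set a} where

  ⟦⟧-true : (A? : Dec A) → A → ⟦ A? ⟧ ≡ 1ℤ
  ⟦⟧-true (yes _) a = refl
  ⟦⟧-true (no ¬a) a = contradiction a ¬a

  ⟦⟧-false : (A? : Dec A) → ¬ A → ⟦ A? ⟧ ≡ 0ℤ
  ⟦⟧-false (yes a) ¬a = contradiction a ¬a
  ⟦⟧-false (no _)  ¬a = refl

⟦⟧-cong : ∀ {a b} {A : Set a} {B : Set b} (A? : Dec A) (B? : Dec B) → (A → B) → (B → A) → ⟦ A? ⟧ ≡ ⟦ B? ⟧
⟦⟧-cong (yes a) B? A⇒B B⇒A = sym (⟦⟧-true B? (A⇒B a))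
⟦⟧-cong (no ¬a) B? A⇒B B⇒A = sym (⟦⟧-false B? (¬a ∘ B⇒A))

∑-pick : ∀ {n a} (F : ℕ → ℤ) → a < n → ∑ n (λ k → ⟦ suc a ℕ.≟ suc k ⟧ * F (suc k)) ≡ F (suc a)
∑-pick {suc n} {zero} F _ = begin
  1ℤ * F 1 + ∑ n (λ k → 0ℤ * F (suc (suc k)))  ≡⟨ cong (_+_ (1ℤ * F 1)) (∑-zero n) ⟩
  1ℤ * F 1 + 0ℤ                              ≡⟨ unit (F 1) ⟩
  F 1                                        ∎
  where
  unit : ∀ x → 1ℤ * x + 0ℤ ≡ x
  unit = solve-∀
∑-pick {suc n} {suc a} F (s≤s a<n) = begin
  0ℤ * F 1 + ∑ n (λ k → ⟦ suc (suc a) ℕ.≟ suc (suc k) ⟧ * F (suc (suc k)))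
    ≡⟨ ℤ.+-identityˡ _ ⟩
  ∑ n (λ k → ⟦ suc (suc a) ℕ.≟ suc (suc k) ⟧ * F (suc (suc k)))
    ≡⟨ ∑-cong n (λ k _ → cong (_* F (suc (suc k)))
         (⟦⟧-cong (suc (suc a) ℕ.≟ suc (suc k)) (suc a ℕ.≟ suc k) ℕ.suc-injective (cong suc))) ⟩
  ∑ n (λ k → ⟦ suc a ℕ.≟ suc k ⟧ * F (suc (suc k)))
    ≡⟨ ∑-pick (F ∘ suc) a<n ⟩
  F (suc (suc a)) ∎

-- Induction on `m` splits off the first block of `d` indices, whose only multiple of `d` is `d`
-- itself; the other blocks are translates, handled by translating `F`.
∑-multiples : ∀ m d .{{_ : NonZero d}} (F : ℕ → ℤ) →
  ∑ (m ℕ.* d) (λ j → ⟦ d ∣? suc j ⟧ * F (suc j)) ≡ ∑ m (λ k → F (suc k ℕ.* d))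
∑-multiples zero    d       F = refl
∑-multiples (suc m) d@(suc e) F = begin
  ∑ (d ℕ.+ m ℕ.* d) (λ j → ⟦ d ∣? suc j ⟧ * F (suc j))
    ≡⟨ ∑-split d (m ℕ.* d) (λ j → ⟦ d ∣? suc j ⟧ * F (suc j)) ⟩
  ∑ d (λ j → ⟦ d ∣? suc j ⟧ * F (suc j)) + ∑ (m ℕ.* d) (λ j → ⟦ d ∣? suc (d ℕ.+ j) ⟧ * F (suc (d ℕ.+ j)))
    ≡⟨ cong₂ _+_ first rest ⟩
  F (1 ℕ.* d) + ∑ m (λ k → F (suc (suc k) ℕ.* d)) ∎
  where
  first : ∑ d (λ j → ⟦ d ∣? suc j ⟧ * F (suc j)) ≡ F (1 ℕ.* d)
  first = begin
    ∑ d (λ j → ⟦ d ∣? suc j ⟧ * F (suc j))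
      ≡⟨ ∑-cong d (λ j j<d → cong (_* F (suc j)) (⟦⟧-cong (d ∣? suc j) (d ℕ.≟ suc j)
           (λ d∣j → ℕ.≤-antisym (ℕ.∣⇒≤ d∣j) j<d) ℕ.∣-reflexive)) ⟩
    ∑ d (λ j → ⟦ d ℕ.≟ suc j ⟧ * F (suc j))
      ≡⟨ ∑-pick F (ℕ.n<1+n e) ⟩
    F d
      ≡⟨ cong F (sym (ℕ.*-identityˡ d)) ⟩
    F (1 ℕ.* d) ∎
  step : ∀ j → ⟦ d ∣? suc (d ℕ.+ j) ⟧ * F (suc (d ℕ.+ j)) ≡ ⟦ d ∣? suc j ⟧ * F (d ℕ.+ suc j)
  step j rewrite sym (ℕ.+-suc d j) = cong (_* F (d ℕ.+ suc j))
    (⟦⟧-cong (d ∣? (d ℕ.+ suc j)) (d ∣? suc j) (λ p → ℕ.∣m+n∣m⇒∣n p ℕ.∣-refl) (ℕ.∣m∣n⇒∣m+n ℕ.∣-refl))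
  rest : ∑ (m ℕ.* d) (λ j → ⟦ d ∣? suc (d ℕ.+ j) ⟧ * F (suc (d ℕ.+ j))) ≡ ∑ m (λ k → F (suc (suc k) ℕ.* d))
  rest = trans (∑-cong (m ℕ.* d) (λ j _ → step j)) (∑-multiples m d (F ∘ (d ℕ.+_)))

-- Filtered lists as bracket sums.

module _ {P : ℕ → Set} (P? : Decidable P) where

  length-filter-applyUpTo : ∀ f n → + length (filter P? (applyUpTo f n)) ≡ ∑ n (λ k → ⟦ P? (f k) ⟧)
  length-filter-applyUpTo f zero = refl
  length-filter-applyUpTo f (suc n) with P? (f 0)
  ... | yes _ = cong (_+_ 1ℤ) (length-filter-applyUpTo (f ∘ suc) n)
  ... | no  _ = trans (length-filter-applyUpTo (f ∘ suc) n) (sym (ℤ.+-identityˡ _))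

  foldr-filter-applyUpTo : ∀ (h : ℕ → ℤ) f n →
    foldr _+_ 0ℤ (map h (filter P? (applyUpTo f n))) ≡ ∑ n (λ k → ⟦ P? (f k) ⟧ * h (f k))
  foldr-filter-applyUpTo h f zero = refl
  foldr-filter-applyUpTo h f (suc n) with P? (f 0)
  ... | yes _ = cong₂ _+_ (sym (ℤ.*-identityˡ (h (f 0)))) (foldr-filter-applyUpTo h (f ∘ suc) n)
  ... | no  _ = trans (foldr-filter-applyUpTo h (f ∘ suc) n) (sym (ℤ.+-identityˡ _))

-- Gcd sums and the totient.

gcdSum : ℕ → (ℕ → ℤ) → ℤ
gcdSum n v = ∑ n (λ j → v (gcd (suc j) n))

-- As gcd(kd, md) = d·gcd(k, m), multiplication by `d` matches the k ≤ m coprime to `m` with the j ≤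
-- md whose gcd with md is `d`.
φ-counts-gcd : ∀ m d .{{_ : NonZero d}} → + φ m ≡ ∑ (m ℕ.* d) (λ j → ⟦ gcd (suc j) (m ℕ.* d) ℕ.≟ d ⟧)
φ-counts-gcd m d = begin
  + φ m
    ≡⟨ length-filter-applyUpTo (λ k → coprime? k m) suc m ⟩
  ∑ m (λ k → ⟦ coprime? (suc k) m ⟧)
    ≡⟨ ∑-cong m (λ k _ → ⟦⟧-cong (coprime? (suc k) m) (gcd (suc k ℕ.* d) n ℕ.≟ d) (to k) (from k)) ⟩
  ∑ m (λ k → ⟦ gcd (suc k ℕ.* d) n ℕ.≟ d ⟧)
    ≡⟨ sym (∑-multiples m d (λ j → ⟦ gcd j n ℕ.≟ d ⟧)) ⟩
  ∑ n (λ j → ⟦ d ∣? suc j ⟧ * ⟦ gcd (suc j) n ℕ.≟ d ⟧)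
    ≡⟨ ∑-cong n (λ j _ → absorb j) ⟩
  ∑ n (λ j → ⟦ gcd (suc j) n ℕ.≟ d ⟧) ∎
  where
  n = m ℕ.* d
  gcd-scale : ∀ k → gcd (suc k ℕ.* d) n ≡ d ℕ.* gcd (suc k) m
  gcd-scale k = trans (cong₂ gcd (ℕ.*-comm (suc k) d) (ℕ.*-comm m d)) (sym (c*gcd[m,n]≡gcd[cm,cn] d (suc k) m))
  to : ∀ k → Coprime (suc k) m → gcd (suc k ℕ.* d) n ≡ d
  to k c = trans (gcd-scale k) (trans (cong (d ℕ.*_) (coprime⇒gcd≡1 c)) (ℕ.*-identityʳ d))
  from : ∀ k → gcd (suc k ℕ.* d) n ≡ d → Coprime (suc k) m
  from k eq = gcd≡1⇒coprime (ℕ.*-cancelˡ-≡ _ _ d (trans (sym (gcd-scale k)) (trans eq (sym (ℕ.*-identityʳ d)))))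
  -- A gcd equal to `d` already forces `d` to divide j.
  absorb : ∀ j → ⟦ d ∣? suc j ⟧ * ⟦ gcd (suc j) n ℕ.≟ d ⟧ ≡ ⟦ gcd (suc j) n ℕ.≟ d ⟧
  absorb j with gcd (suc j) n ℕ.≟ d
  ... | no  _  = ℤ.*-zeroʳ ⟦ d ∣? suc j ⟧
  ... | yes eq = trans (ℤ.*-identityʳ _) (⟦⟧-true (d ∣? suc j) (subst (ℕ._∣ suc j) eq (gcd[m,n]∣m (suc j) n)))

-- The gcd divides a positive number, so it is a successor, and it is at most `n`. This lets
-- functions defined by cases on zero compute at a gcd.
gcd-suc : ∀ j n .{{_ : NonZero n}} (R : ℕ → Set) → (∀ k → k < n → R (suc k)) → R (gcd (suc j) n)
gcd-suc j n R r with gcd (suc j) n | gcd[m,n]∣m (suc j) n | gcd[m,n]≤n (suc j) n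
... | zero  | 0∣j | _   = contradiction (ℕ.0∣⇒≡0 0∣j) λ ()
... | suc k | _   | k<n = r k k<n

-- Each φ(n/d) is expanded into the j with gcd(j, n) = d. After exchanging the sums, every j picks
-- out exactly one d, its gcd with `n`.
divisorSum-φ : ∀ n .{{_ : NonZero n}} (v : ℕ → ℤ) →
  divisorSum n (λ d → + φ (n / d) * v d) ≡ gcdSum n v
divisorSum-φ n v = begin
  divisorSum n (λ d → + φ (n / d) * v d)
    ≡⟨ foldr-filter-applyUpTo (λ k → suc k ∣? n) (λ k → + φ (n / suc k) * v (suc k)) id n ⟩
  ∑ n (λ k → ⟦ suc k ∣? n ⟧ * (+ φ (n / suc k) * v (suc k)))
    ≡⟨ ∑-cong n (λ k _ → term k) ⟩
  ∑ n (λ k → ∑ n (λ j → ⟦ gcd (suc j) n ℕ.≟ suc k ⟧ * v (suc k)))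
    ≡⟨ ∑-swap n n _ ⟩
  ∑ n (λ j → ∑ n (λ k → ⟦ gcd (suc j) n ℕ.≟ suc k ⟧ * v (suc k)))
    ≡⟨ ∑-cong n (λ j _ → gcd-suc j n (λ g → ∑ n (λ k → ⟦ g ℕ.≟ suc k ⟧ * v (suc k)) ≡ v g) (λ k → ∑-pick v)) ⟩
  gcdSum n v ∎
  where
  term : ∀ k → ⟦ suc k ∣? n ⟧ * (+ φ (n / suc k) * v (suc k)) ≡ ∑ n (λ j → ⟦ gcd (suc j) n ℕ.≟ suc k ⟧ * v (suc k))
  term k with suc k ∣? n
  ... | yes (ℕ.divides-refl q) = begin
    1ℤ * (+ φ (n / suc k) * v (suc k))
      ≡⟨ ℤ.*-identityˡ _ ⟩
    + φ (n / suc k) * v (suc k)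
      ≡⟨ cong (λ m → + φ m * v (suc k)) (m*n/n≡m q (suc k)) ⟩
    + φ q * v (suc k)
      ≡⟨ cong (_* v (suc k)) (φ-counts-gcd q (suc k)) ⟩
    ∑ n (λ j → ⟦ gcd (suc j) n ℕ.≟ suc k ⟧) * v (suc k)
      ≡⟨ sym (∑-distribʳ-* n _ (v (suc k))) ⟩
    ∑ n (λ j → ⟦ gcd (suc j) n ℕ.≟ suc k ⟧ * v (suc k)) ∎
  -- A non-divisor of `n` is never a gcd with `n`, so both sides vanish.
  ... | no k∤n = sym (trans (∑-cong n (λ j _ → cong (_* v (suc k)) (⟦⟧-false (gcd (suc j) n ℕ.≟ suc k)
                   (λ eq → k∤n (subst (ℕ._∣ n) eq (gcd[m,n]∣n (suc j) n)))))) (∑-zero n))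

-- This is w_d. Although d divides 0, the value at 0 is 0, because a logarithmic derivative x g′/g
-- has no constant term.
multiplesOf : ℕ → ℕ → ℤ
multiplesOf d zero    = 0ℤ
multiplesOf d (suc n) = ⟦ d ∣? suc n ⟧ * + d

-- If `d` divides `n`, then `d` divides gcd(j, n) exactly when it divides j; the n/d such j
-- contribute `d` each, in total `n`. Otherwise `d` divides no gcd with `n` and the sum is 0.
gcdSum-multiplesOf : ∀ n .{{_ : NonZero n}} d .{{_ : NonZero d}} → + n ∣ gcdSum n (multiplesOf d)
gcdSum-multiplesOf n d with d ∣? n
... | yes (ℕ.divides-refl m) = divides 1ℤ (begin
  gcdSum n (multiplesOf d)
    ≡⟨ ∑-cong n (λ j _ → term j) ⟩
  ∑ n (λ j → ⟦ d ∣? suc j ⟧ * + d)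
    ≡⟨ ∑-multiples m d (λ _ → + d) ⟩
  ∑ m (λ _ → + d)
    ≡⟨ ∑-const m (+ d) ⟩
  + m * + d
    ≡⟨ sym (ℤ.pos-* m d) ⟩
  + n
    ≡⟨ sym (ℤ.*-identityˡ (+ n)) ⟩
  1ℤ * + n ∎)
  where
  unfold : ∀ j → multiplesOf d (gcd (suc j) n) ≡ ⟦ d ∣? gcd (suc j) n ⟧ * + d
  unfold j = gcd-suc j n (λ g → multiplesOf d g ≡ ⟦ d ∣? g ⟧ * + d) (λ _ _ → refl)
  term : ∀ j → multiplesOf d (gcd (suc j) n) ≡ ⟦ d ∣? suc j ⟧ * + d
  term j = trans (unfold j) (cong (_* + d) (⟦⟧-cong (d ∣? gcd (suc j) n) (d ∣? suc j)
    (λ d∣g → ℕ.∣-trans d∣g (gcd[m,n]∣m (suc j) n)) (λ d∣j → gcd-greatest d∣j (ℕ.n∣m*n m))))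
... | no d∤n = ∑-∣ n (λ j _ → subst (+ n ∣_) (sym (term j)) (divides 0ℤ refl))
  where
  term : ∀ j → multiplesOf d (gcd (suc j) n) ≡ 0ℤ
  term j = gcd-suc j n (λ g → g ℕ.∣ n → multiplesOf d g ≡ 0ℤ)
    (λ k _ k∣n → cong (_* + d) (⟦⟧-false (d ∣? suc k) (λ d∣k → d∤n (ℕ.∣-trans d∣k k∣n)))) (gcd[m,n]∣n (suc j) n)

-- Power series and the Cauchy product.

infixl 7 _⊛_

_⊛_ : (ℕ → ℤ) → (ℕ → ℤ) → ℕ → ℤ
(f ⊛ g) zero    = f 0 * g 0
(f ⊛ g) (suc n) = f 0 * g (suc n) + (f ∘ suc ⊛ g) n

⊛-congʳ : ∀ f {g h} → g ≗ h → f ⊛ g ≗ f ⊛ h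
⊛-congʳ f g≗h zero    = cong (f 0 *_) (g≗h 0)
⊛-congʳ f g≗h (suc n) = cong₂ _+_ (cong (f 0 *_) (g≗h (suc n))) (⊛-congʳ (f ∘ suc) g≗h n)

⊛-distribˡ-+ : ∀ f g h → f ⊛ (λ k → g k + h k) ≗ λ n → (f ⊛ g) n + (f ⊛ h) n
⊛-distribˡ-+ f g h zero    = ℤ.*-distribˡ-+ (f 0) (g 0) (h 0)
⊛-distribˡ-+ f g h (suc n) =
  trans (cong (_+_ (f 0 * (g (suc n) + h (suc n)))) (⊛-distribˡ-+ (f ∘ suc) g h n))
    (rearrange (f 0) (g (suc n)) (h (suc n)) _ _)
  where
  rearrange : ∀ a b c x y → a * (b + c) + (x + y) ≡ (a * b + x) + (a * c + y)
  rearrange = solve-∀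

⊛-distribʳ-- : ∀ f g h → (λ k → f k - g k) ⊛ h ≗ λ n → (f ⊛ h) n - (g ⊛ h) n
⊛-distribʳ-- f g h zero    = rearrange (f 0) (g 0) (h 0)
  where
  rearrange : ∀ a b c → (a - b) * c ≡ a * c - b * c
  rearrange = solve-∀
⊛-distribʳ-- f g h (suc n) =
  trans (cong (_+_ ((f 0 - g 0) * h (suc n))) (⊛-distribʳ-- (f ∘ suc) (g ∘ suc) h n))
    (rearrange (f 0) (g 0) (h (suc n)) _ _)
  where
  rearrange : ∀ a b c x y → (a - b) * c + (x - y) ≡ (a * c + x) - (b * c + y)
  rearrange = solve-∀

⊛-distribˡ-- : ∀ f g h → f ⊛ (λ k → g k - h k) ≗ λ n → (f ⊛ g) n - (f ⊛ h) n
⊛-distribˡ-- f g h zero    = rearrange (f 0) (g 0) (h 0)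
  where
  rearrange : ∀ a b c → a * (b - c) ≡ a * b - a * c
  rearrange = solve-∀
⊛-distribˡ-- f g h (suc n) =
  trans (cong (_+_ (f 0 * (g (suc n) - h (suc n)))) (⊛-distribˡ-- (f ∘ suc) g h n))
    (rearrange (f 0) (g (suc n)) (h (suc n)) _ _)
  where
  rearrange : ∀ a b c x y → a * (b - c) + (x - y) ≡ (a * b + x) - (a * c + y)
  rearrange = solve-∀

⊛-∣ : ∀ {d} f g n → (∀ k → k ℕ.≤ n → d ∣ f k) → d ∣ (f ⊛ g) n
⊛-∣ f g zero    d∣f = ∣m⇒∣m*n (g 0) (d∣f 0 z≤n)
⊛-∣ f g (suc n) d∣f =
  ∣m∣n⇒∣m+n (∣m⇒∣m*n (g (suc n)) (d∣f 0 z≤n)) (⊛-∣ (f ∘ suc) g n (λ k k≤n → d∣f (suc k) (s≤s k≤n)))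

constant : ℤ → ℕ → ℤ
constant c zero    = c
constant c (suc n) = 0ℤ

⊛-constant : ∀ f c n → (f ⊛ constant c) n ≡ f n * c
⊛-constant f c zero    = refl
⊛-constant f c (suc n) = trans (cong₂ _+_ (ℤ.*-zeroʳ (f 0)) (⊛-constant (f ∘ suc) c n)) (ℤ.+-identityˡ _)

-- Multiplication by powers of x.

shift : ℕ → (ℕ → ℤ) → ℕ → ℤ
shift zero    f n       = f n
shift (suc d) f zero    = 0ℤ
shift (suc d) f (suc n) = shift d f n

shift-< : ∀ {d n} f → n < d → shift d f n ≡ 0ℤ
shift-< {suc d} {zero}  f _         = refl
shift-< {suc d} {suc n} f (s≤s n<d) = shift-< f n<d

shift-+ : ∀ d f n → shift d f (d ℕ.+ n) ≡ f n
shift-+ zero    f n = refl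
shift-+ (suc d) f n = shift-+ d f n

shift-cong : ∀ d {f g} → f ≗ g → shift d f ≗ shift d g
shift-cong zero    f≗g n       = f≗g n
shift-cong (suc d) f≗g zero    = refl
shift-cong (suc d) f≗g (suc n) = shift-cong d f≗g n

shift-distrib-+ : ∀ d f g n → shift d (λ k → f k + g k) n ≡ shift d f n + shift d g n
shift-distrib-+ zero    f g n       = refl
shift-distrib-+ (suc d) f g zero    = refl
shift-distrib-+ (suc d) f g (suc n) = shift-distrib-+ d f g n

shift-*ʳ : ∀ d f c n → shift d (λ k → f k * c) n ≡ shift d f n * c
shift-*ʳ zero    f c n       = refl
shift-*ʳ (suc d) f c zero    = refl
shift-*ʳ (suc d) f c (suc n) = shift-*ʳ d f c n

shift-zero : ∀ d n → shift d (λ _ → 0ℤ) n ≡ 0ℤ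
shift-zero zero    n       = refl
shift-zero (suc d) zero    = refl
shift-zero (suc d) (suc n) = shift-zero d n

shift-⊛ : ∀ d f g → shift d f ⊛ g ≗ shift d (f ⊛ g)
shift-⊛ zero    f g n       = refl
shift-⊛ (suc d) f g zero    = refl
shift-⊛ (suc d) f g (suc n) = trans (ℤ.+-identityˡ _) (shift-⊛ d f g n)

⊛-shift : ∀ d f g → f ⊛ shift d g ≗ shift d (f ⊛ g)
⊛-shift zero    f g n       = refl
⊛-shift (suc d) f g zero    = ℤ.*-zeroʳ (f 0)
⊛-shift (suc d) f g (suc n) = trans (⊛-shift-suc f n) (⊛-shift d f g n)
  where
  -- The product recurses along its first factor, so pulling x out of the second needs an induction
  -- in which `f` varies.
  ⊛-shift-suc : ∀ f n → (f ⊛ shift (suc d) g) (suc n) ≡ (f ⊛ shift d g) n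
  ⊛-shift-suc f zero    = trans (cong (_+_ (f 0 * shift d g 0)) (ℤ.*-zeroʳ (f 1))) (ℤ.+-identityʳ _)
  ⊛-shift-suc f (suc n) = cong (_+_ (f 0 * shift d g (suc n))) (⊛-shift-suc (f ∘ suc) n)

-- The Leibniz rule for the derivation x·d/dx applied to xᵈ f.
shift-derivation : ∀ d f n → + n * shift d f n ≡ + d * shift d f n + shift d (λ k → + k * f k) n
shift-derivation zero    f n       = sym (ℤ.+-identityˡ _)
shift-derivation (suc d) f zero    = sym (trans (ℤ.+-identityʳ _) (ℤ.*-zeroʳ (+ suc d)))
shift-derivation (suc d) f (suc n) = begin
  + suc n * s                  ≡⟨ ℤ.suc-* (+ n) s ⟩
  s + + n * s                  ≡⟨ cong (_+_ s) (shift-derivation d f n) ⟩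
  s + (+ d * s + s′)           ≡⟨ sym (ℤ.+-assoc s _ s′) ⟩
  (s + + d * s) + s′           ≡⟨ cong (_+ s′) (sym (ℤ.suc-* (+ d) s)) ⟩
  + suc d * s + s′             ∎
  where
  s  = shift d f n
  s′ = shift d (λ k → + k * f k) n

-- The generating function of w_d is the geometric series d·xᵈ/(1 - xᵈ); this is that formula with
-- the denominator cleared.
multiplesOf-shift : ∀ d .{{_ : NonZero d}} n →
  multiplesOf d n - shift d (multiplesOf d) n ≡ shift d (constant (+ d)) n
multiplesOf-shift d n with n ℕ.<? d
... | yes n<d = trans (cong₂ _-_ (small n n<d) (shift-< (multiplesOf d) n<d)) (sym (shift-< (constant (+ d)) n<d))
  where
  small : ∀ n → n < d → multiplesOf d n ≡ 0ℤ
  small zero    _   = refl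
  small (suc n) n<d = cong (_* + d) (⟦⟧-false (d ∣? suc n) (ℕ.>⇒∤ n<d))
... | no n≮d = subst (λ n → multiplesOf d n - shift d (multiplesOf d) n ≡ shift d (constant (+ d)) n)
                 (ℕ.m+[n∸m]≡n (ℕ.≮⇒≥ n≮d)) (large d (n ℕ.∸ d))
  where
  diag : ∀ d .{{_ : NonZero d}} → multiplesOf d d ≡ + d
  diag d@(suc _) = trans (cong (_* + d) (⟦⟧-true (d ∣? d) ℕ.∣-refl)) (ℤ.*-identityˡ (+ d))
  periodic : ∀ d .{{_ : NonZero d}} k → multiplesOf d (d ℕ.+ suc k) ≡ multiplesOf d (suc k)
  periodic d@(suc _) k = cong (_* + d) (⟦⟧-cong (d ∣? (d ℕ.+ suc k)) (d ∣? suc k)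
    (λ p → ℕ.∣m+n∣m⇒∣n p ℕ.∣-refl) (ℕ.∣m∣n⇒∣m+n ℕ.∣-refl))
  large : ∀ d .{{_ : NonZero d}} k →
    multiplesOf d (d ℕ.+ k) - shift d (multiplesOf d) (d ℕ.+ k) ≡ shift d (constant (+ d)) (d ℕ.+ k)
  large d k rewrite shift-+ d (multiplesOf d) k | shift-+ d (constant (+ d)) k with k
  -- In degree `d` the subtracted value is w_d(0) = 0, so `d` survives; in higher degrees
  -- periodicity cancels everything.
  ... | zero  = trans (ℤ.+-identityʳ _) (trans (cong (multiplesOf d) (ℕ.+-identityʳ d)) (diag d))
  ... | suc k = trans (cong (_- multiplesOf d (suc k)) (periodic d k)) (ℤ.+-inverseʳ (multiplesOf d (suc k)))

-- Newton's identities x·g′ = −g·v, i.e. v is minus the logarithmic derivative of g.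
Newton : (ℕ → ℤ) → (ℕ → ℤ) → Set
Newton v g = ∀ n → + n * g n + (g ⊛ v) n ≡ 0ℤ

-- Newton's identities under a factor 1 - xᵈ.

times1-x^ : ℕ → (ℕ → ℤ) → ℕ → ℤ
times1-x^ d g n = g n - shift d g n

-- Logarithmic derivatives of products add, and minus that of 1 - xᵈ is d·xᵈ/(1 - xᵈ), the series of
-- w_d. The computation is done without division.
Newton-times1-x^ : ∀ d .{{_ : NonZero d}} {v g} → Newton v g → Newton (λ n → v n + multiplesOf d n) (times1-x^ d g)
Newton-times1-x^ d {v} {g} vg n = begin
  + n * (g n - s) + (times1-x^ d g ⊛ (λ n → v n + w n)) n
    ≡⟨ cong (_+_ (+ n * (g n - s))) (trans (⊛-distribˡ-+ (times1-x^ d g) v w n) (cong₂ _+_ with-v with-w)) ⟩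
  + n * (g n - s) + (((g ⊛ v) n - shift d (g ⊛ v) n) + s * + d)
    ≡⟨ rearrange₁ (+ n) (g n) s _ _ (+ d) ⟩
  (+ n * g n + (g ⊛ v) n) - + n * s - shift d (g ⊛ v) n + s * + d
    ≡⟨ cong₂ (λ a b → a - b - shift d (g ⊛ v) n + s * + d) (vg n) (shift-derivation d g n) ⟩
  0ℤ - (+ d * s + s′) - shift d (g ⊛ v) n + s * + d
    ≡⟨ rearrange₂ (+ d) s s′ _ ⟩
  -- What remains is minus xᵈ times Newton's identity for `v` and `g`.
  - (s′ + shift d (g ⊛ v) n)
    ≡⟨ cong -_ (trans (sym (shift-distrib-+ d _ _ n)) (trans (shift-cong d vg n) (shift-zero d n))) ⟩
  0ℤ ∎
  where
  w  = multiplesOf d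
  s  = shift d g n
  s′ = shift d (λ k → + k * g k) n
  rearrange₁ : ∀ n g s a b d → n * (g - s) + ((a - b) + s * d) ≡ (n * g + a) - n * s - b + s * d
  rearrange₁ = solve-∀
  rearrange₂ : ∀ d s s′ b → 0ℤ - (d * s + s′) - b + s * d ≡ - (s′ + b)
  rearrange₂ = solve-∀
  with-v : (times1-x^ d g ⊛ v) n ≡ (g ⊛ v) n - shift d (g ⊛ v) n
  with-v = trans (⊛-distribʳ-- g (shift d g) v n) (cong (_-_ ((g ⊛ v) n)) (shift-⊛ d g v n))
  with-w : (times1-x^ d g ⊛ w) n ≡ s * + d
  -- The factor xᵈ is moved from `g` to `w`, where (1 - xᵈ)·w = d·xᵈ applies.
  with-w = begin
    (times1-x^ d g ⊛ w) n               ≡⟨ ⊛-distribʳ-- g (shift d g) w n ⟩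
    (g ⊛ w) n - (shift d g ⊛ w) n       ≡⟨ cong (_-_ ((g ⊛ w) n)) (trans (shift-⊛ d g w n) (sym (⊛-shift d g w n))) ⟩
    (g ⊛ w) n - (g ⊛ shift d w) n       ≡⟨ sym (⊛-distribˡ-- g w (shift d w) n) ⟩
    (g ⊛ times1-x^ d w) n               ≡⟨ ⊛-congʳ g (multiplesOf-shift d) n ⟩
    (g ⊛ shift d (constant (+ d))) n    ≡⟨ ⊛-shift d g _ n ⟩
    shift d (g ⊛ constant (+ d)) n      ≡⟨ shift-cong d (⊛-constant g (+ d)) n ⟩
    shift d (λ k → g k * + d) n         ≡⟨ shift-*ʳ d g (+ d) n ⟩
    s * + d ∎

-- Since g(0) = 1, Newton's identity in degree k + 1 can be solved for v(k + 1). Every other term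
-- contains a coefficient of `g` of degree between 1 and k + 1, so no induction on `v` is required.
Newton-∣ : ∀ {m v g} n → g 0 ≡ 1ℤ → Newton v g → (∀ k → k < n → m ∣ g (suc k)) →
  ∀ k → k < n → m ∣ v (suc k)
Newton-∣ {m} {v} {g} n g0≡1 vg m∣g k k<n = subst (m ∣_) solved
  (∣m∣n⇒∣m-n (∣n⇒∣m*n (- + suc k) (m∣g k k<n))
             (⊛-∣ (g ∘ suc) v k (λ i i≤k → m∣g i (ℕ.≤-<-trans i≤k k<n))))
  where
  r = (g ∘ suc ⊛ v) k
  rearrange : ∀ n g v r → - n * g - r ≡ v - (n * g + (1ℤ * v + r))
  rearrange = solve-∀
  solved : - + suc k * g (suc k) - r ≡ v (suc k)
  solved = begin
    - + suc k * g (suc k) - r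
      ≡⟨ rearrange (+ suc k) (g (suc k)) (v (suc k)) r ⟩
    v (suc k) - (+ suc k * g (suc k) + (1ℤ * v (suc k) + r))
      ≡⟨ cong (λ c → v (suc k) - (+ suc k * g (suc k) + (c * v (suc k) + r))) (sym g0≡1) ⟩
    v (suc k) - (+ suc k * g (suc k) + (g ⊛ v) (suc k))
      ≡⟨ cong (_-_ (v (suc k))) (vg (suc k)) ⟩
    v (suc k) - 0ℤ
      ≡⟨ ℤ.+-identityʳ _ ⟩
    v (suc k) ∎

-- Clearing the coefficients of g modulo n.

Newton⇒∣gcdSum : ∀ n .{{_ : NonZero n}} {v g} → g 0 ≡ 1ℤ → Newton v g → + n ∣ gcdSum n v
Newton⇒∣gcdSum n g0≡1 vg = clear n 0 (ℕ.+-identityʳ n) g0≡1 vg (λ _ ())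
  where
  -- Degrees 1, …, k of g are done, m = n − k are left; strip lowers the coefficient c of xᵏ⁺¹ to 0.
  clear : ∀ m k → m ℕ.+ k ≡ n → ∀ {v g} → g 0 ≡ 1ℤ → Newton v g →
    (∀ j → j < k → + n ∣ g (suc j)) → + n ∣ gcdSum n v
  clear zero k refl {v} g0≡1 vg n∣g =
    ∑-∣ n (λ j _ → gcd-suc j n (λ d → + n ∣ v d) (Newton-∣ n g0≡1 vg n∣g))
  clear (suc m) k m+k≡n {g = g} g0≡1 vg n∣g =
    -- The number of factors 1 - xᵏ⁺¹ to multiply in is the least nonnegative residue of the
    -- coefficient.
    strip (g (suc k) ℤ.%ℕ n) g0≡1 vg n∣g
      (divides (g (suc k) ℤ./ℕ n) (trans (cong (_- + r) (ℤ.a≡a%ℕn+[a/ℕn]*n (g (suc k)) n)) (cancel (+ r) _)))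
    where
    r = g (suc k) ℤ.%ℕ n
    cancel : ∀ a b → (a + b) - a ≡ b
    cancel = solve-∀
    strip : ∀ c {v g} → g 0 ≡ 1ℤ → Newton v g → (∀ j → j < k → + n ∣ g (suc j)) →
      + n ∣ g (suc k) - + c → + n ∣ gcdSum n v
    strip zero {g = g} g0≡1 vg n∣g n∣gk = clear m (suc k) (trans (ℕ.+-suc m k) m+k≡n) g0≡1 vg n∣g′
      where
      n∣g′ : ∀ j → j < suc k → + n ∣ g (suc j)
      n∣g′ j j<1+k with j ℕ.≟ k
      ... | yes refl = subst (+ n ∣_) (ℤ.+-identityʳ _) n∣gk
      ... | no j≢k   = n∣g j (ℕ.≤∧≢⇒< (ℕ.≤-pred j<1+k) j≢k)
    -- One factor 1 - xᵏ⁺¹ keeps g(0) = 1 and lowers the next coefficient by g(0). The divisibility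
    -- obtained for v + w is carried back to `v` by removing the gcd sum of w.
    strip (suc c) {v} {g} g0≡1 vg n∣g n∣gk = ∣m+n∣n⇒∣m
      (subst (+ n ∣_) (∑-distrib-+ n _ _)
        (strip c (trans (ℤ.+-identityʳ (g 0)) g0≡1) (Newton-times1-x^ (suc k) vg) low top))
      (gcdSum-multiplesOf n (suc k))
      where
      -- Degrees 1 to `k` are unaffected, as xᵏ⁺¹ g starts in degree k + 1.
      low : ∀ j → j < k → + n ∣ g (suc j) - shift k g j
      low j j<k = subst (+ n ∣_) (sym (trans (cong (_-_ (g (suc j))) (shift-< g j<k)) (ℤ.+-identityʳ _))) (n∣g j j<k)
      shift-diag : shift k g k ≡ 1ℤ
      shift-diag = trans (cong (shift k g) (sym (ℕ.+-identityʳ k))) (trans (shift-+ k g 0) g0≡1)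
      regroup : ∀ a c → a - (1ℤ + c) ≡ a - 1ℤ - c
      regroup = solve-∀
      top : + n ∣ g (suc k) - shift k g k - + c
      top = subst (+ n ∣_)
        (trans (regroup (g (suc k)) (+ c)) (cong (λ s → g (suc k) - s - + c) (sym shift-diag))) n∣gk

-- Lucas sequences.

module _ (P Q : ℤ) where

  reciprocalCharPoly : ℕ → ℤ
  reciprocalCharPoly 0 = 1ℤ
  reciprocalCharPoly 1 = - P
  reciprocalCharPoly 2 = Q
  reciprocalCharPoly (suc (suc (suc n))) = 0ℤ

  -- V₀ = 2 is replaced by 0, as the logarithmic derivative has no constant term.
  V⁺ : ℕ → ℤ
  V⁺ zero    = 0ℤ
  V⁺ (suc n) = V P Q (suc n)

  -- If α and β are the roots of t² - Pt + Q, the polynomial is (1 - αx)(1 - βx) and V_n = αⁿ + βⁿ,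
  -- so these are the classical identities for power sums. From degree 3 on they are the Lucas
  -- recurrence.
  Newton-V⁺ : Newton V⁺ reciprocalCharPoly
  Newton-V⁺ 0 = refl
  Newton-V⁺ 1 = identity P
    where
    identity : ∀ p → 1ℤ * - p + (1ℤ * p + - p * 0ℤ) ≡ 0ℤ
    identity = solve-∀
  -- Here V₀ = 2 enters through V₂ = P² - 2Q and cancels the term 2Q.
  Newton-V⁺ 2 = identity P Q
    where
    identity : ∀ p q → + 2 * q + (1ℤ * (p * p - q * + 2) + (- p * p + q * 0ℤ)) ≡ 0ℤ
    identity = solve-∀
  Newton-V⁺ (suc (suc (suc n))) = begin
    + suc (suc (suc n)) * 0ℤ + (1ℤ * (P * x - Q * y) + (- P * x + tail))
      ≡⟨ cong (λ t → + suc (suc (suc n)) * 0ℤ + (1ℤ * (P * x - Q * y) + (- P * x + t))) tail≡ ⟩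
    + suc (suc (suc n)) * 0ℤ + (1ℤ * (P * x - Q * y) + (- P * x + (Q * y + 0ℤ)))
      ≡⟨ identity (+ suc (suc (suc n))) P Q x y ⟩
    0ℤ ∎
    where
    x = V P Q (suc (suc n))
    y = V P Q (suc n)
    tail = ((λ k → reciprocalCharPoly (suc (suc k))) ⊛ V⁺) (suc n)
    zero-⊛ : ∀ m → ((λ _ → 0ℤ) ⊛ V⁺) m ≡ 0ℤ
    zero-⊛ zero    = refl
    zero-⊛ (suc m) = trans (ℤ.+-identityˡ _) (zero-⊛ m)
    tail≡ : tail ≡ Q * y + 0ℤ
    tail≡ = cong (_+_ (Q * y)) (zero-⊛ n)
    identity : ∀ k p q x y → k * 0ℤ + (1ℤ * (p * x - q * y) + (- p * x + (q * y + 0ℤ))) ≡ 0ℤ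
    identity = solve-∀

  -- The changed value at 0 is invisible to the gcd sum, since gcds with `n` are positive.
  ∣gcdSum-V : ∀ n .{{_ : NonZero n}} → + n ∣ gcdSum n (V P Q)
  ∣gcdSum-V n = subst (+ n ∣_)
    (∑-cong n (λ j _ → gcd-suc j n (λ d → V⁺ d ≡ V P Q d) (λ _ _ → refl)))
    (Newton⇒∣gcdSum n refl Newton-V⁺)

-- The prime case and the congruences.

gcdSum-prime : ∀ {p} → Prime p → ∀ v → gcdSum p v ≡ + p * v 1 + (v p - v 1)
gcdSum-prime {zero}  pr v = contradiction pr λ ()
gcdSum-prime {p@(suc m)} pr v = begin
  gcdSum p v
    ≡⟨ ∑-cong p term ⟩
  -- For 1 ≤ j < p the gcd with `p` is 1, so the summand is v(1) plus a correction supported at j =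
  -- p.
  ∑ p (λ j → v 1 + ⟦ p ℕ.≟ suc j ⟧ * (v (suc j) - v 1))
    ≡⟨ ∑-distrib-+ p (λ _ → v 1) (λ j → ⟦ p ℕ.≟ suc j ⟧ * (v (suc j) - v 1)) ⟩
  ∑ p (λ _ → v 1) + ∑ p (λ j → ⟦ p ℕ.≟ suc j ⟧ * (v (suc j) - v 1))
    ≡⟨ cong₂ _+_ (∑-const p (v 1)) (∑-pick (λ j → v j - v 1) (ℕ.n<1+n m)) ⟩
  + p * v 1 + (v p - v 1) ∎
  where
  term : ∀ j → j < p → v (gcd (suc j) p) ≡ v 1 + ⟦ p ℕ.≟ suc j ⟧ * (v (suc j) - v 1)
  term j j<p with p ℕ.≟ suc j
  ... | yes refl = trans (cong v (ℕ.∣-antisym (gcd[m,n]∣m p p) (gcd-greatest ℕ.∣-refl ℕ.∣-refl))) (split (v 1) (v p))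
    where
    split : ∀ a b → b ≡ a + 1ℤ * (b - a)
    split = solve-∀
  ... | no p≢j   = trans (cong v (coprime⇒gcd≡1 (coprime-sym (prime⇒coprime pr (ℕ.≤∧≢⇒< j<p (p≢j ∘ sym))))))
                     (sym (ℤ.+-identityʳ (v 1)))

corollary2 : (n : ℕ) → .{{_ : NonZero n}} → (P : ℕ) → (Q : ℤ) →
    - (+ P) - 1ℤ ≤ Q → Q ≤ 0ℤ →
    (divisorSum n (λ d → + φ (n / d) * V (+ P) Q d) ≡ 0ℤ [mod n ])
    × (Prime n → V (+ P) Q n ≡ + P [mod n ])
corollary2 n P Q _ _ = sum≡0 , prime
  where
  v = V (+ P) Q
  sum≡0 : divisorSum n (λ d → + φ (n / d) * v d) ≡ 0ℤ [mod n ]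
  sum≡0 = subst (+ n ∣_) (sym (trans (ℤ.+-identityʳ _) (divisorSum-φ n v))) (∣gcdSum-V (+ P) Q n)
  prime : Prime n → v n ≡ + P [mod n ]
  -- The gcd sum is n·P + (V_n - P) because V₁ = P; subtracting n·P leaves the claim.
  prime pr = subst (+ n ∣_) (cancel (+ n * + P) (v n - + P))
    (∣m∣n⇒∣m-n (subst (+ n ∣_) (gcdSum-prime pr v) (∣gcdSum-V (+ P) Q n)) (∣m⇒∣m*n (+ P) ∣-refl))
    where
    cancel : ∀ a b → (a + b) - a ≡ b
    cancel = solve-∀
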